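{- The map $\Phi_{1,\mathrm{sym}}$ is (defined on and restricts to) a length-preserving bijection from the set $\mathcal M^{\mathrm{bicol}}$ of bicoloured Motzkin paths to the set $\mathcal Q^{\mathrm{sym}}$ of quarter-plane walks with steps in $S_{1,\mathrm{sym}}$, and the map $\Psi_{1,\mathrm{sym}}$ (restricted to $\mathcal Q^{\mathrm{sym}}$) is the inverse bijection. Moreover, for every $n\in\mathbb N$, all the maps in the chain $$\mathcal Q^{\mathrm{sym}}(n)\xrightarrow{\ \Psi_{1,\mathrm{sym}}\ }\mathcal M^{\mathrm{bicol}}(n)\cong\mathcal M(n)\times 2^{[n]}\xrightarrow{\ \Phi_1\times\mathrm{id}\ }\mathcal Q(n)\times 2^{[n]}$$ are bijections, so that $|\mathcal Q^{\mathrm{sym}}(n)|=2^n\,|\mathcal Q(n)|$.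
   Context: $\mathbb N$ contains $0$; $2^{[n]}$ is the power set of $\{1,\dots,n\}$. For a class $\mathcal X$ of words, $\mathcal X(n)$ is the set of its words of length $n$. Classes of walks. $\mathcal M$: Motzkin words, i.e. words on $\{ -1,0,1\}$ with total sum $0$ and all prefix sums $\ge0$. $\mathcal M^{\mathrm{bicol}}$: bicoloured Motzkin words, i.e. Motzkin words each letter of which carries one of two colours, "solid" or "striped" (the six coloured letters form the alphabet $\Sigma_{1,\mathrm{bicol}}$). The bijection $\mathcal M^{\mathrm{bicol}}(n)\cong\mathcal M(n)\times2^{[n]}$ sends a bicoloured word to the pair (underlying uncoloured word, set of positions of its striped letters). $S_1=\{(0,1),(-1,0),(1,-1)\}$ and $S_{1,\mathrm{sym}}=S_1\cup\{(1,0),(0,-1),(-1,1)\}$. $\mathcal Q$ (resp. $\mathcal Q^{\mathrm{sym}}$): words on $S_1$ (resp. $S_{1,\mathrm{sym}}$) all of whose prefixes have letter sum in $\mathbb N^2$. Transitions for the six-step model. A transition relates an input letter in $\Sigma_{1,\mathrm{bicol}}$ and a left counter $(h_L,v_L)\in\mathbb N^2$ to a right counter $(h_R,v_R)\in\mathbb N^2$ and an output letter in $S_{1,\mathrm{sym}}$. With arbitrary $\alpha,\beta\in\mathbb N$: (U1) solid $+1;\ (\alpha,\beta)\to(\alpha,\beta+1);\ (0,1)$. (L2) solid $0;\ (\alpha,\beta+1)\to(\alpha+1,\beta);\ (1,-1)$. (L1) solid $0;\ (\alpha,0)\to(\alpha,0);\ (0,1)$. (D3) solid $-1;\ (\alpha+1,\beta)\to(\alpha,\beta);\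 (-1,0)$. (D2) solid $-1;\ (0,\beta+1)\to(0,\beta);\ (1,-1)$. (DE) solid $-1;\ (0,0)\to$ error. (U1$'$) striped $+1;\ (\alpha,\beta)\to(\alpha+1,\beta);\ (1,0)$. (L2$'$) striped $0;\ (\alpha+1,\beta)\to(\alpha,\beta+1);\ (-1,1)$. (L1$'$) striped $0;\ (0,\beta)\to(0,\beta);\ (1,0)$. (D3$'$) striped $-1;\ (\alpha,\beta+1)\to(\alpha,\beta);\ (0,-1)$. (D2$'$) striped $-1;\ (\alpha+1,0)\to(\alpha,0);\ (-1,1)$. (DE$'$) striped $-1;\ (0,0)\to$ error. Each triple (input letter, $h_L,v_L$) matches exactly one transition, and each triple ($h_R,v_R$, output letter) matches the right side of exactly one non-error transition and determines its left side. $\Phi_{1,\mathrm{sym}}$: given a word $w_1\cdots w_n$ on $\Sigma_{1,\mathrm{bicol}}$, start with $(h_0,v_0)=(0,0)$; for $i=1,\dots,n$ apply the unique transition matching $(w_i,h_{i-1},v_{i-1})$ to get $(h_i,v_i)$ and $\bar w_i$; undefined if an error transition is used, otherwise the value is $\bar w_1\cdots\bar w_n$. $\Psi_{1,\mathrm{sym}}$: given $\bar w_1\cdots\bar w_n$ on $S_{1,\mathrm{sym}}$, start with $(h_n,v_n)=(0,0)$; for $i=n,\dots,1$ apply in reverse the unique non-error transition matching $(h_i,v_i,\bar w_i)$ to get $w_i$ and $(h_{i-1},v_{i-1})$; the value is $w_1\cdots w_n$. $\Phi_1$: the partial map from words on $\{ -1,0,1\}$ to words on $S_1$ defined in the same left-to-right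 way as $\Phi_{1,\mathrm{sym}}$, using only the transitions (U1), (L2), (L1), (D3), (D2), (DE), with the colour "solid" dropped from the input letters. -}

module Defs where

open import Data.Fin.Base using (Fin)
open import Data.Fin.Subset using (Subset; Side; inside; outside)
open import Data.Integer.Base as ℤ using (ℤ; 0ℤ; 1ℤ; -1ℤ)
open import Data.List.Base using (List; []; _∷_; foldr; inits; length; map)
open import Data.List.Properties using (length-map)
open import Data.List.Relation.Unary.All using (All)
open import Data.Maybe.Base as Maybe using (Maybe; just; nothing)
open import Data.Nat.Base using (ℕ; zero; suc)
open import Data.Product.Base using (_×_; _,_; proj₁; proj₂; ∃-syntax)
open import Data.Refinement.Base using (Refinement-syntax; _,_)
open import Data.Irrelevant using ([_])
open import Data.Vec.Base using (cast; fromList)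
open import Function.Base using (_∘_)
open import Function.Bundles using (_↔_)
open import Relation.Binary.PropositionalEquality.Core using (_≡_; refl; trans)

HasCardinality : Set → ℕ → Set
HasCardinality A k = A ↔ Fin k

-- Membership proofs are irrelevant in a refinement type, so two elements of
-- Words P are propositionally equal as soon as the underlying words are.

Words : {A : Set} → (List A → Set) → Set
Words {A} P = [ w ∈ List A ∣ P w ]

WordsOfLength : {A : Set} → (List A → Set) → ℕ → Set
WordsOfLength {A} P n = [ w ∈ List A ∣ (P w × length w ≡ n) ]

data Step : Set where
  up level down : Step

height : Step → ℤ
height up    = 1ℤ
height level = 0ℤ
height down  = -1ℤ

sumℤ : List ℤ → ℤ
sumℤ = foldr ℤ._+_ 0ℤ

total : List Step → ℤ
total w = sumℤ (map height w)

Motzkin : List Step → Set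
Motzkin w = total w ≡ 0ℤ × All (λ p → 0ℤ ℤ.≤ total p) (inits w)

data Colour : Set where
  solid striped : Colour

BicolStep : Set
BicolStep = Step × Colour

uncolour : List BicolStep → List Step
uncolour = map proj₁

BicolMotzkin : List BicolStep → Set
BicolMotzkin w = Motzkin (uncolour w)

stripedSide : Colour → Side
stripedSide striped = inside
stripedSide solid   = outside

stripedPositions : (w : List BicolStep) → Subset (length (map (stripedSide ∘ proj₂) w))
stripedPositions w = fromList (map (stripedSide ∘ proj₂) w)

splitColours : (n : ℕ) → WordsOfLength BicolMotzkin n → WordsOfLength Motzkin n × Subset n
splitColours n (w , [ m ]) =
  (uncolour w , [ (proj₁ m , trans (length-map proj₁ w) (proj₂ m)) ]) ,
  cast (trans (length-map (stripedSide ∘ proj₂) w) (proj₂ m)) (stripedPositions w)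

data S₁ : Set where
  N W SE : S₁

data S₁Sym : Set where
  base   : S₁ → S₁Sym
  E S NW : S₁Sym

vec₁ : S₁ → ℤ × ℤ
vec₁ N  = 0ℤ , 1ℤ
vec₁ W  = -1ℤ , 0ℤ
vec₁ SE = 1ℤ , -1ℤ

vec₁Sym : S₁Sym → ℤ × ℤ
vec₁Sym (base s) = vec₁ s
vec₁Sym E        = 1ℤ , 0ℤ
vec₁Sym S        = 0ℤ , -1ℤ
vec₁Sym NW       = -1ℤ , 1ℤ

InQuadrant : ℤ × ℤ → Set
InQuadrant (x , y) = 0ℤ ℤ.≤ x × 0ℤ ℤ.≤ y

sumℤ² : List (ℤ × ℤ) → ℤ × ℤ
sumℤ² ps = sumℤ (map proj₁ ps) , sumℤ (map proj₂ ps)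

QuarterPlane : {A : Set} → (A → ℤ × ℤ) → List A → Set
QuarterPlane vec q = All (λ p → InQuadrant (sumℤ² (map vec p))) (inits q)

Quarter : List S₁ → Set
Quarter = QuarterPlane vec₁

QuarterSym : List S₁Sym → Set
QuarterSym = QuarterPlane vec₁Sym

Counter : Set
Counter = ℕ × ℕ

-- Transition₁ a l o relates an input letter and a left counter to an outcome:
-- a right counter and an output letter, or an error (nothing).

data Transition₁ : Step → Counter → Maybe (Counter × S₁) → Set where
  U1 : ∀ {α β} → Transition₁ up    (α     , β)     (just ((α     , suc β) , N))
  L2 : ∀ {α β} → Transition₁ level (α     , suc β) (just ((suc α , β)     , SE))
  L1 : ∀ {α}   → Transition₁ level (α     , 0)     (just ((α     , 0)     , N))
  D3 : ∀ {α β} → Transition₁ down  (suc α , β)     (just ((α     , β)     , W))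
  D2 : ∀ {β}   → Transition₁ down  (0     , suc β) (just ((0     , β)     , SE))
  DE :           Transition₁ down  (0     , 0)     nothing

data Transition₁Sym : BicolStep → Counter → Maybe (Counter × S₁Sym) → Set where
  unprimed      : ∀ {a l r s} → Transition₁ a l (just (r , s)) →
                  Transition₁Sym (a , solid) l (just (r , base s))
  unprimedError : ∀ {a l} → Transition₁ a l nothing →
                  Transition₁Sym (a , solid) l nothing
  U1′ : ∀ {α β} → Transition₁Sym (up    , striped) (α     , β)     (just ((suc α , β)     , E))
  L2′ : ∀ {α β} → Transition₁Sym (level , striped) (suc α , β)     (just ((α     , suc β) , NW))
  L1′ : ∀ {β}   → Transition₁Sym (level , striped) (0     , β)     (just ((0     , β)     , E))
  D3′ : ∀ {α β} → Transition₁Sym (down  , striped) (α     , suc β) (just ((α     , β)     , S))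
  D2′ : ∀ {α}   → Transition₁Sym (down  , striped) (suc α , 0)     (just ((α     , 0)     , NW))
  DE′ :           Transition₁Sym (down  , striped) (0     , 0)     nothing

forward₁ : ∀ a l → ∃[ o ] Transition₁ a l o
forward₁ up    (α     , β)     = _ , U1
forward₁ level (α     , suc β) = _ , L2
forward₁ level (α     , zero)  = _ , L1
forward₁ down  (suc α , β)     = _ , D3
forward₁ down  (zero  , suc β) = _ , D2
forward₁ down  (zero  , zero)  = _ , DE

forward₁-unique : ∀ {a l o o′} → Transition₁ a l o → Transition₁ a l o′ → o ≡ o′
forward₁-unique U1 U1 = refl
forward₁-unique L2 L2 = refl
forward₁-unique L1 L1 = refl
forward₁-unique D3 D3 = refl
forward₁-unique D2 D2 = refl
forward₁-unique DE DE = refl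

forward₁Sym : ∀ a l → ∃[ o ] Transition₁Sym a l o
forward₁Sym (a , solid) l with forward₁ a l
... | just (r , s) , t = just (r , base s) , unprimed t
... | nothing      , t = nothing , unprimedError t
forward₁Sym (up    , striped) (α     , β)     = _ , U1′
forward₁Sym (level , striped) (suc α , β)     = _ , L2′
forward₁Sym (level , striped) (zero  , β)     = _ , L1′
forward₁Sym (down  , striped) (α     , suc β) = _ , D3′
forward₁Sym (down  , striped) (suc α , zero)  = _ , D2′
forward₁Sym (down  , striped) (zero  , zero)  = _ , DE′

forward₁Sym-unique : ∀ {a l o o′} → Transition₁Sym a l o → Transition₁Sym a l o′ → o ≡ o′
forward₁Sym-unique (unprimed t)      (unprimed t′) with refl ← forward₁-unique t t′ = refl
forward₁Sym-unique (unprimed t)      (unprimedError t′) with () ← forward₁-unique t t′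
forward₁Sym-unique (unprimedError t) (unprimed t′) with () ← forward₁-unique t t′
forward₁Sym-unique (unprimedError t) (unprimedError t′) = refl
forward₁Sym-unique U1′ U1′ = refl
forward₁Sym-unique L2′ L2′ = refl
forward₁Sym-unique L1′ L1′ = refl
forward₁Sym-unique D3′ D3′ = refl
forward₁Sym-unique D2′ D2′ = refl
forward₁Sym-unique DE′ DE′ = refl

backward₁Sym : ∀ r s → ∃[ al ] Transition₁Sym (proj₁ al) (proj₂ al) (just (r , s))
backward₁Sym (α     , suc β) (base N)  = _ , unprimed U1
backward₁Sym (α     , zero)  (base N)  = _ , unprimed L1
backward₁Sym (suc α , β)     (base SE) = _ , unprimed L2
backward₁Sym (zero  , β)     (base SE) = _ , unprimed D2
backward₁Sym (α     , β)     (base W)  = _ , unprimed D3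
backward₁Sym (suc α , β)     E         = _ , U1′
backward₁Sym (zero  , β)     E         = _ , L1′
backward₁Sym (α     , suc β) NW        = _ , L2′
backward₁Sym (α     , zero)  NW        = _ , D2′
backward₁Sym (α     , β)     S         = _ , D3′

backward₁Sym-unique : ∀ {a a′ l l′ r s} →
  Transition₁Sym a l (just (r , s)) → Transition₁Sym a′ l′ (just (r , s)) →
  (a , l) ≡ (a′ , l′)
backward₁Sym-unique (unprimed U1) (unprimed U1) = refl
backward₁Sym-unique (unprimed L2) (unprimed L2) = refl
backward₁Sym-unique (unprimed L1) (unprimed L1) = refl
backward₁Sym-unique (unprimed D3) (unprimed D3) = refl
backward₁Sym-unique (unprimed D2) (unprimed D2) = refl
backward₁Sym-unique U1′ U1′ = refl
backward₁Sym-unique L2′ L2′ = refl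
backward₁Sym-unique L1′ L1′ = refl
backward₁Sym-unique D3′ D3′ = refl
backward₁Sym-unique D2′ D2′ = refl

leftToRight : {A B : Set} → (A → Counter → Maybe (Counter × B)) →
              Counter → List A → Maybe (List B)
leftToRight next l []      = just []
leftToRight next l (a ∷ w) with next a l
... | just (r , s) = Maybe.map (s ∷_) (leftToRight next r w)
... | nothing      = nothing

Φ₁ : List Step → Maybe (List S₁)
Φ₁ = leftToRight (λ a l → proj₁ (forward₁ a l)) (0 , 0)

Φ₁Sym : List BicolStep → Maybe (List S₁Sym)
Φ₁Sym = leftToRight (λ a l → proj₁ (forward₁Sym a l)) (0 , 0)

-- Returns the preimage letters together with the counter to their left.

rightToLeft : List S₁Sym → List BicolStep × Counter
rightToLeft []      = [] , (0 , 0)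
rightToLeft (s ∷ q) with rightToLeft q
... | w , r with backward₁Sym r s
... | (a , l) , _ = a ∷ w , l

Ψ₁Sym : List S₁Sym → List BicolStep
Ψ₁Sym q = proj₁ (rightToLeft q)

{-# OPTIONS --safe #-}

-- Along a run, h + v is the height of the Motzkin path, and a coordinate of the counter changes
-- exactly like the same coordinate of the quarter-plane walk, except that at 0 it may ignore a
-- step +1.  Hence the counter stays below the position of the walk once it starts below it, and,
-- read backwards, the counter is below the position throughout if it is so at the end and the walk
-- stays in the quadrant.  So the words related by a run from counter (0 , 0) to counter (0 , 0)
-- are a Motzkin word and a quadrant walk, every Motzkin word and every quadrant walk has such a
-- run, and runs are deterministic in both directions.
module Submission where

open import Defs
open import Algebra.Properties.CommutativeSemigroup as CommutativeSemigroup using ()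
open import Algebra.Properties.AbelianGroup as AbelianGroup using ()
open import Data.Empty using (⊥-elim-irr)
open import Data.Fin.Base using (Fin; zero; suc)
open import Data.Fin.Properties using (2↔Bool; *↔×; 1↔⊤)
open import Data.Fin.Subset using (Side; Subset; inside; outside)
open import Data.Integer.Base as ℤ using (ℤ; 0ℤ; 1ℤ; +_)
import Data.Integer.Properties as ℤ
open import Data.Irrelevant using ([_])
open import Data.List.Base as List using (List; []; _∷_; inits; length; zipWith)
open import Data.List.Properties using (length-map; map-id; ∷-injectiveˡ; ∷-injectiveʳ)
open import Data.List.Relation.Unary.All as All using (All; []; _∷_; all?)
open import Data.List.Relation.Unary.All.Properties using (map⁺; map⁻)
open import Data.Maybe.Base as Maybe using (Maybe; just; nothing)
open import Data.Maybe.Properties using (just-injective)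
open import Data.Nat.Base using (ℕ; zero; suc; _*_; _^_; z≤n)
import Data.Nat.Base as ℕ
import Data.Nat.Properties as ℕ
open import Data.Product.Algebra using (×-comm)
open import Data.Product.Base using (Σ-syntax; ∃-syntax; _×_; map; _,_; proj₁; proj₂)
open import Data.Product.Function.NonDependent.Propositional using (_×-↔_)
open import Data.Refinement.Base using (Refinement-syntax; value; _,_)
open import Data.Refinement.Properties using (value-injective)
open import Data.Unit.Base using (tt)
open import Data.Vec.Base using (Vec; []; _∷_; toList; fromList; cast)
open import Data.Vec.Properties using (toList-injective; cast-is-id; toList∘fromList; length-toList)
open import Function.Base using (id; _∘_)
open import Function.Bundles using (_↔_; mk↔ₛ′; module Inverse; module Bijection; mk⤖)
open import Function.Consequences.Propositional using (strictlySurjective⇒surjective)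
open import Function.Definitions using (Bijective; Injective; StrictlySurjective)
open import Function.Properties.Bijection using (⤖⇒↔)
open import Function.Properties.Inverse using (↔-refl; ↔-sym; ↔-trans; ↔⇒⤖)
open import Relation.Binary.PropositionalEquality.Core
  using (_≡_; refl; sym; trans; cong; cong₂; subst; subst₂)
open import Relation.Nullary using (¬_; yes; no; contradiction; recompute)
open import Relation.Nullary.Decidable.Core using (_×-dec_)
open import Relation.Unary using (Decidable)

private
  variable
    A B : Set

-- Bijections between refinement types

module _ {P : A → Set} {Q : B → Set} (R : A → B → Set)
         (P? : Decidable P) (Q? : Decidable Q)
         (rightward : ∀ {a} → P a → ∃[ b ] R a b × Q b)
         (leftward : ∀ {b} → Q b → ∃[ a ] R a b × P a)
         (functional : ∀ {a b b′} → R a b → R a b′ → b ≡ b′)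
         (injective : ∀ {a a′ b} → R a b → R a′ b → a ≡ a′)
         where

  private
    to : [ a ∈ A ∣ P a ] → [ b ∈ B ∣ Q b ]
    -- The proof in a refinement is irrelevant, so decidability is used to recover one from which
    -- `rightward` can compute.
    to (a , [ p ]) with b , _ , q ← rightward (recompute (P? a) p) = b , [ q ]

    to-related : ∀ x → R (value x) (value (to x))
    to-related (a , [ p ]) with _ , ρ , _ ← rightward (recompute (P? a) p) = ρ

    from : [ b ∈ B ∣ Q b ] → [ a ∈ A ∣ P a ]
    from (b , [ q ]) with a , _ , p ← leftward (recompute (Q? b) q) = a , [ p ]

    from-related : ∀ y → R (value (from y)) (value y)
    from-related (b , [ q ]) with _ , ρ , _ ← leftward (recompute (Q? b) q) = ρ

  -- The two composites are identities because `R` is functional in both directions. That `R` holds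
  -- along both maps is kept in the conclusion: it later identifies them with the maps computed
  -- letter by letter.
  relation⇒↔ : Σ[ φ ∈ ([ a ∈ A ∣ P a ] ↔ [ b ∈ B ∣ Q b ]) ]
      (∀ x → R (value x) (value (Inverse.to φ x)))
    × (∀ y → R (value (Inverse.from φ y)) (value y))
  relation⇒↔ =
    mk↔ₛ′ to from
      (λ y → value-injective (functional (to-related (from y)) (from-related y)))
      (λ x → value-injective (injective (from-related (to x)) (to-related x))) ,
    to-related , from-related

-- Finiteness

finite-Fin : ∀ k {P : Fin k → Set} → Decidable P → ∃[ b ] HasCardinality [ i ∈ Fin k ∣ P i ] b
finite-Fin zero P? = 0 , mk↔ₛ′ (λ { (() , _) }) (λ ()) (λ ()) (λ { (() , _) })
finite-Fin (suc k) {P} P? with finite-Fin k (P? ∘ suc) | P? zero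
... | b , φ | yes p = suc b , mk↔ₛ′ to from to∘from from∘to
  where
  to : [ i ∈ Fin (suc k) ∣ P i ] → Fin (suc b)
  to (zero  , _) = zero
  to (suc i , q) = suc (Inverse.to φ (i , q))
  from : Fin (suc b) → [ i ∈ Fin (suc k) ∣ P i ]
  from zero    = zero , [ p ]
  from (suc j) = let i , q = Inverse.from φ j in suc i , q
  to∘from : ∀ j → to (from j) ≡ j
  to∘from zero    = refl
  to∘from (suc j) = cong suc (Inverse.strictlyInverseˡ φ j)
  from∘to : ∀ x → from (to x) ≡ x
  from∘to (zero  , _) = refl
  from∘to (suc i , q) = value-injective (cong (suc ∘ value) (Inverse.strictlyInverseʳ φ (i , q)))
... | b , φ | no ¬p = b , mk↔ₛ′ to from (Inverse.strictlyInverseˡ φ) from∘to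
  where
  to : [ i ∈ Fin (suc k) ∣ P i ] → Fin b
  to (zero  , [ p ]) = ⊥-elim-irr (¬p p)
  to (suc i , q)     = Inverse.to φ (i , q)
  from : Fin b → [ i ∈ Fin (suc k) ∣ P i ]
  from j = let i , q = Inverse.from φ j in suc i , q
  from∘to : ∀ x → from (to x) ≡ x
  from∘to (zero  , [ p ]) = ⊥-elim-irr (¬p p)
  from∘to (suc i , q) = value-injective (cong (suc ∘ value) (Inverse.strictlyInverseʳ φ (i , q)))

finite-refinement : ∀ {k} {P : A → Set} → HasCardinality A k → Decidable P →
                    ∃[ b ] HasCardinality [ a ∈ A ∣ P a ] b
finite-refinement {k = k} {P} φ P? =
  let b , χ = finite-Fin k (P? ∘ from) in b , ↔-trans reindex χ
  where
  open Inverse φ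
  reindex : [ a ∈ _ ∣ P a ] ↔ [ i ∈ Fin k ∣ P (from i) ]
  reindex = proj₁ (relation⇒↔ (λ a i → a ≡ from i) P? (P? ∘ from)
    (λ {a} p → to a , sym (strictlyInverseʳ a) , subst P (sym (strictlyInverseʳ a)) p)
    (λ p → _ , refl , p)
    (λ {_} {i} {j} a≡i a≡j → trans (sym (strictlyInverseˡ i))
      (trans (cong to (trans (sym a≡i) a≡j)) (strictlyInverseˡ j)))
    (λ a≡i a′≡i → trans a≡i (sym a′≡i)))

Vec-cardinality : ∀ {k} n → HasCardinality A k → HasCardinality (Vec A n) (k ^ n)
Vec-cardinality zero φ =
  ↔-trans (mk↔ₛ′ (λ _ → tt) (λ _ → []) (λ _ → refl) (λ { [] → refl })) (↔-sym 1↔⊤)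
Vec-cardinality {A = A} (suc n) φ =
  ↔-trans uncons (↔-trans (φ ×-↔ Vec-cardinality n φ) (↔-sym *↔×))
  where
  uncons : Vec A (suc n) ↔ (A × Vec A n)
  uncons = mk↔ₛ′ (λ { (x ∷ xs) → x , xs }) (λ { (x , xs) → x ∷ xs })
                 (λ _ → refl) (λ { (_ ∷ _) → refl })

toList-injective-≡ : ∀ {n} (xs ys : Vec A n) → toList xs ≡ toList ys → xs ≡ ys
toList-injective-≡ xs ys eq = trans (sym (cast-is-id refl xs)) (toList-injective refl xs ys eq)

ofLength? : {P : List A → Set} → Decidable P → ∀ n → Decidable (λ w → P w × length w ≡ n)
ofLength? P? n w = P? w ×-dec (length w ℕ.≟ n)

-- Lists of length `n` correspond to vectors, of which there are `k ^ n`, and a decidable predicate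
-- cuts a finite set out of them.
finite-WordsOfLength : ∀ {k} {P : List A → Set} → HasCardinality A k → Decidable P → ∀ n →
                       ∃[ b ] HasCardinality (WordsOfLength P n) b
finite-WordsOfLength {A = A} {P = P} φ P? n =
  let b , χ = finite-refinement (Vec-cardinality n φ) (P? ∘ toList) in b , ↔-trans vectors χ
  where
  vectors : WordsOfLength P n ↔ [ v ∈ Vec A n ∣ P (toList v) ]
  vectors = proj₁ (relation⇒↔ (λ w v → toList v ≡ w) (ofLength? P? n) (P? ∘ toList)
    (λ { {w} (p , refl) → fromList w , toList∘fromList w , subst P (sym (toList∘fromList w)) p })
    (λ {v} p → toList v , refl , p , length-toList v)
    (λ {_} {u} {v} u≡w v≡w → toList-injective-≡ u v (trans u≡w (sym v≡w)))
    (λ v≡w v≡w′ → trans (sym v≡w) v≡w′))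

-- Counters below positions

+-cancelˡ-≤ : ∀ k {i j} → k ℤ.+ i ℤ.≤ k ℤ.+ j → i ℤ.≤ j
+-cancelˡ-≤ k {i} {j} le =
  subst₂ ℤ._≤_ (\\-leftDividesʳ k i) (\\-leftDividesʳ k j) (ℤ.+-monoʳ-≤ (ℤ.- k) le)
  where open AbelianGroup ℤ.+-0-abelianGroup using (\\-leftDividesʳ)

-- The change from `h` to `h′` of one counter coordinate while the same coordinate of the walk moves
-- by `k`.
data _⟶[_]_ : ℕ → ℤ → ℕ → Set where
  follows : ∀ {h k h′} → + h′ ≡ k ℤ.+ + h → h ⟶[ k ] h′
  ignores : 0 ⟶[ 1ℤ ] 0

⟶-≤ : ∀ {h k h′ x} → h ⟶[ k ] h′ → + h ℤ.≤ x → + h′ ℤ.≤ k ℤ.+ x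
⟶-≤ {k = k} {x = x} (follows eq) h≤x = subst (ℤ._≤ k ℤ.+ x) (sym eq) (ℤ.+-monoʳ-≤ k h≤x)
⟶-≤ {x = x}         ignores      0≤x = ℤ.≤-trans 0≤x (ℤ.i≤suc[i] x)

-- For `ignores` the bound after the step only gives `-1 ≤ x`; the hypothesis `0 ≤ x` closes the
-- gap. This is where staying in the quadrant is used.
⟶-≤⁻¹ : ∀ {h k h′ x} → h ⟶[ k ] h′ → 0ℤ ℤ.≤ x → + h′ ℤ.≤ k ℤ.+ x → + h ℤ.≤ x
⟶-≤⁻¹ {k = k} {x = x} (follows eq) _   le = +-cancelˡ-≤ k (subst (ℤ._≤ k ℤ.+ x) eq le)
⟶-≤⁻¹                 ignores      0≤x _  = 0≤x

infixr 6 _⊕_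

_⊕_ : ℤ × ℤ → ℤ × ℤ → ℤ × ℤ
(x , y) ⊕ (x′ , y′) = x ℤ.+ x′ , y ℤ.+ y′

⊕-identityˡ : ∀ p → (0ℤ , 0ℤ) ⊕ p ≡ p
⊕-identityˡ (x , y) = cong₂ _,_ (ℤ.+-identityˡ x) (ℤ.+-identityˡ y)

⊕-identityʳ : ∀ p → p ⊕ (0ℤ , 0ℤ) ≡ p
⊕-identityʳ (x , y) = cong₂ _,_ (ℤ.+-identityʳ x) (ℤ.+-identityʳ y)

_⊑_ : Counter → ℤ × ℤ → Set
(h , v) ⊑ (x , y) = + h ℤ.≤ x × + v ℤ.≤ y

size : Counter → ℤ
size (h , v) = + (h ℕ.+ v)

⊑0⇒≡0 : ∀ {l} → l ⊑ (0ℤ , 0ℤ) → l ≡ (0 , 0)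
⊑0⇒≡0 {zero , zero} _ = refl
⊑0⇒≡0 {zero , suc _} (_ , ℤ.+≤+ ())
⊑0⇒≡0 {suc _ , _} (ℤ.+≤+ () , _)

size≡0⇒≡0 : ∀ {l} → size l ≡ 0ℤ → l ≡ (0 , 0)
size≡0⇒≡0 {zero , zero} _ = refl
size≡0⇒≡0 {zero , suc _} ()
size≡0⇒≡0 {suc _ , _} ()

-- Moves the contribution of the first letter out of a prefix sum and into the starting value.
+-shift : ∀ a b c → (a ℤ.+ b) ℤ.+ c ≡ b ℤ.+ (a ℤ.+ c)
+-shift = xy∙z≈y∙xz
  where open CommutativeSemigroup ℤ.+-commutativeSemigroup using (xy∙z≈y∙xz)

-- An arbitrary starting height `z` makes the condition stable under removal of the first letter, as
-- induction along a run requires. `QuadrantFrom` does the same for walks.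
NonnegFrom : ℤ → List Step → Set
NonnegFrom z w = All (λ p → 0ℤ ℤ.≤ total p ℤ.+ z) (inits w)

nonneg-∷⁻ : ∀ {z} a w → NonnegFrom z (a ∷ w) → NonnegFrom (height a ℤ.+ z) w
nonneg-∷⁻ {z} a w (_ ∷ ps) =
  -- The nonempty prefixes of `a ∷ w` are `a ∷ p` for `p` a prefix of `w`, which is the form `map⁻`
  -- undoes.
  All.map (λ {p} → subst (0ℤ ℤ.≤_) (+-shift (height a) (total p) z)) (map⁻ ps)

nonneg-∷⁺ : ∀ {z} a w → 0ℤ ℤ.≤ z → NonnegFrom (height a ℤ.+ z) w → NonnegFrom z (a ∷ w)
nonneg-∷⁺ {z} a w 0≤z ps = subst (0ℤ ℤ.≤_) (sym (ℤ.+-identityˡ z)) 0≤z ∷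
  map⁺ (All.map (λ {p} → subst (0ℤ ℤ.≤_) (sym (+-shift (height a) (total p) z))) ps)

nonneg-start : ∀ {z} w → NonnegFrom z w → 0ℤ ℤ.≤ z
nonneg-start {z} _ (p ∷ _) = subst (0ℤ ℤ.≤_) (ℤ.+-identityˡ z) p

module _ (vec : B → ℤ × ℤ) where

  position : List B → ℤ × ℤ
  position q = sumℤ² (List.map vec q)

  QuadrantFrom : ℤ × ℤ → List B → Set
  QuadrantFrom p q = All (λ u → InQuadrant (position u ⊕ p)) (inits q)

  position-shift : ∀ p s u → position (s ∷ u) ⊕ p ≡ position u ⊕ (vec s ⊕ p)
  position-shift p s u = cong₂ _,_ (+-shift (proj₁ (vec s)) (proj₁ (position u)) (proj₁ p))
                                   (+-shift (proj₂ (vec s)) (proj₂ (position u)) (proj₂ p))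

  quadrant-∷⁻ : ∀ {p} s q → QuadrantFrom p (s ∷ q) → QuadrantFrom (vec s ⊕ p) q
  quadrant-∷⁻ {p} s q (_ ∷ ps) =
    All.map (λ {u} → subst InQuadrant (position-shift p s u)) (map⁻ ps)

  quadrant-∷⁺ : ∀ {p} s q → InQuadrant p → QuadrantFrom (vec s ⊕ p) q → QuadrantFrom p (s ∷ q)
  quadrant-∷⁺ {p} s q i ps = subst InQuadrant (sym (⊕-identityˡ p)) i ∷
    map⁺ (All.map (λ {u} → subst InQuadrant (sym (position-shift p s u))) ps)

  quadrant-start : ∀ {p} q → QuadrantFrom p q → InQuadrant p
  quadrant-start {p} _ (i ∷ _) = subst InQuadrant (⊕-identityˡ p) i

⊑⇒InQuadrant : ∀ {l p} → l ⊑ p → InQuadrant p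
⊑⇒InQuadrant (h≤x , v≤y) = ℤ.≤-trans (ℤ.+≤+ z≤n) h≤x , ℤ.≤-trans (ℤ.+≤+ z≤n) v≤y

Motzkin? : Decidable Motzkin
Motzkin? w = (total w ℤ.≟ 0ℤ) ×-dec all? (λ p → 0ℤ ℤ.≤? total p) (inits w)

QuarterPlane? : (vec : B → ℤ × ℤ) → Decidable (QuarterPlane vec)
QuarterPlane? vec q = all? (λ p → (0ℤ ℤ.≤? _) ×-dec (0ℤ ℤ.≤? _)) (inits q)

-- Runs

-- The laws common to the three-step and six-step models: determinism in both directions, the
-- counter size as path height, errors only where the path would go below 0, and coordinates that
-- follow the walk except at 0. The bijection is derived from them once and instantiated twice.
record TransitionSystem (A B : Set) : Set₁ where
  field
    Transition      : A → Counter → Maybe (Counter × B) → Set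
    step            : A → Step
    vec             : B → ℤ × ℤ
    forward         : ∀ a l → ∃[ o ] Transition a l o
    forward-unique  : ∀ {a l o o′} → Transition a l o → Transition a l o′ → o ≡ o′
    backward        : ∀ r s → ∃[ al ] Transition (proj₁ al) (proj₂ al) (just (r , s))
    backward-unique : ∀ {a a′ l l′ r s} → Transition a l (just (r , s)) →
                      Transition a′ l′ (just (r , s)) → (a , l) ≡ (a′ , l′)
    size-step       : ∀ {a l r s} → Transition a l (just (r , s)) →
                      size r ≡ height (step a) ℤ.+ size l
    error-negative  : ∀ {a l} → Transition a l nothing → ¬ (0ℤ ℤ.≤ height (step a) ℤ.+ size l)
    horizontal      : ∀ {a l r s} → Transition a l (just (r , s)) →
                      proj₁ l ⟶[ proj₁ (vec s) ] proj₁ r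
    vertical        : ∀ {a l r s} → Transition a l (just (r , s)) →
                      proj₂ l ⟶[ proj₂ (vec s) ] proj₂ r

  infixr 5 _∷_

  -- A relation with no preferred direction, to which both the left-to-right and the right-to-left
  -- algorithm can be compared.
  data Run : Counter → List A → Counter → List B → Set where
    []  : ∀ {l} → Run l [] l []
    _∷_ : ∀ {a l m r s w q} → Transition a l (just (m , s)) → Run m w r q →
          Run l (a ∷ w) r (s ∷ q)

  Run₀ : List A → List B → Set
  Run₀ w q = Run (0 , 0) w (0 , 0) q

  run-length : ∀ {l w r q} → Run l w r q → length q ≡ length w
  run-length []      = refl
  run-length (_ ∷ ρ) = cong suc (run-length ρ)

  run-leftToRight : ∀ {l w r q} → Run l w r q →
                    leftToRight (λ a l → proj₁ (forward a l)) l w ≡ just q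
  run-leftToRight [] = refl
  run-leftToRight (_∷_ {a} {l} {s = s} t ρ) with o , t′ ← forward a l
    rewrite forward-unique t′ t = cong (Maybe.map (s ∷_)) (run-leftToRight ρ)

  run-functional : ∀ {l w r r′ q q′} → Run l w r q → Run l w r′ q′ → q ≡ q′
  run-functional ρ ρ′ = just-injective (trans (sym (run-leftToRight ρ)) (run-leftToRight ρ′))

  -- The tails are compared first: equality of their left counters is what lets `backward-unique`
  -- apply to the first transitions. Hence the left counters belong to the conclusion.
  run-injective : ∀ {l l′ w w′ r q} → Run l w r q → Run l′ w′ r q → (w , l) ≡ (w′ , l′)
  run-injective []      []        = refl
  run-injective (t ∷ ρ) (t′ ∷ ρ′)
    with refl ← run-injective ρ ρ′ with refl ← backward-unique t t′ = refl

  nonneg⇒run : ∀ l w → NonnegFrom (size l) (List.map step w) → ∃[ r ] ∃[ q ] Run l w r q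
  nonneg⇒run l []      _  = l , [] , []
  nonneg⇒run l (a ∷ w) ps with forward a l | nonneg-∷⁻ (step a) (List.map step w) ps
  -- The empty prefix of the remaining word already bounds the height after `a` below by 0, which an
  -- error forbids.
  ... | nothing      , t | ps′ = contradiction (nonneg-start _ ps′) (error-negative t)
  ... | just (m , s) , t | ps′
    with r , q , ρ ← nonneg⇒run m w (subst (λ z → NonnegFrom z _) (sym (size-step t)) ps′)
    = r , s ∷ q , t ∷ ρ

  -- The height after each prefix is the size of a counter, hence a natural number.
  run⇒nonneg : ∀ {l w r q} → Run l w r q → NonnegFrom (size l) (List.map step w)
  run⇒nonneg []      = ℤ.+≤+ z≤n ∷ []
  run⇒nonneg (t ∷ ρ) = nonneg-∷⁺ _ _ (ℤ.+≤+ z≤n)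
    (subst (λ z → NonnegFrom z _) (size-step t) (run⇒nonneg ρ))

  run-total : ∀ {l w r q} → Run l w r q → total (List.map step w) ℤ.+ size l ≡ size r
  run-total []      = ℤ.+-identityˡ _
  run-total {l} (_∷_ {a} {w = w} t ρ) =
    trans (+-shift (height (step a)) (total (List.map step w)) (size l))
      (trans (cong (ℤ._+_ (total (List.map step w))) (sym (size-step t))) (run-total ρ))

  -- Each transition preserves `l ⊑ p`, and a position above a counter has nonnegative coordinates.
  run⇒quadrant : ∀ {l w r q p} → Run l w r q → l ⊑ p → QuadrantFrom vec p q
  run⇒quadrant {p = p} [] l⊑p =
    subst InQuadrant (sym (⊕-identityˡ p)) (⊑⇒InQuadrant l⊑p) ∷ []
  run⇒quadrant (t ∷ ρ) l⊑p@(h≤x , v≤y) = quadrant-∷⁺ vec _ _ (⊑⇒InQuadrant l⊑p)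
    (run⇒quadrant ρ (⟶-≤ (horizontal t) h≤x , ⟶-≤ (vertical t) v≤y))

  -- Induction from the right end, where the counter is `(0 , 0)` and being below the final position
  -- means exactly that this position lies in the quadrant.
  quadrant⇒⊑ : ∀ {l w q p} → Run l w (0 , 0) q → QuadrantFrom vec p q → l ⊑ p
  quadrant⇒⊑ []      ps = quadrant-start vec _ ps
  quadrant⇒⊑ (_∷_ {s = s} {q = q} t ρ) ps
    with 0≤x , 0≤y ← quadrant-start vec (s ∷ q) ps
       | h≤x , v≤y ← quadrant⇒⊑ ρ (quadrant-∷⁻ vec s q ps)
    = ⟶-≤⁻¹ (horizontal t) 0≤x h≤x , ⟶-≤⁻¹ (vertical t) 0≤y v≤y

  backward-run : ∀ r q → ∃[ l ] ∃[ w ] Run l w r q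
  backward-run r []      = r , [] , []
  backward-run r (s ∷ q) with m , w , ρ ← backward-run r q with (a , l) , t ← backward m s
    = l , a ∷ w , t ∷ ρ

  -- Runs from zero to zero: Motzkin words and quadrant walks

  MotzkinInput : List A → Set
  MotzkinInput w = Motzkin (List.map step w)

  run₀⇒Motzkin : ∀ {w q} → Run₀ w q → MotzkinInput w
  run₀⇒Motzkin ρ =
    trans (sym (ℤ.+-identityʳ _)) (run-total ρ) ,
    All.map (subst (0ℤ ℤ.≤_) (ℤ.+-identityʳ _)) (run⇒nonneg ρ)

  Motzkin⇒run₀ : ∀ {w} → MotzkinInput w → ∃[ q ] Run₀ w q
  Motzkin⇒run₀ {w} (total≡0 , ps)
    with r , q , ρ ← nonneg⇒run (0 , 0) w
           (All.map (subst (0ℤ ℤ.≤_) (sym (ℤ.+-identityʳ _))) ps)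
    -- The size of the last counter is the total of the word, so total 0 forces that counter to be
    -- `(0 , 0)`.
    with refl ← size≡0⇒≡0 {r} (trans (sym (run-total ρ)) (trans (ℤ.+-identityʳ _) total≡0))
    = q , ρ

  run₀⇒quarter : ∀ {w q} → Run₀ w q → QuarterPlane vec q
  run₀⇒quarter ρ = All.map (subst InQuadrant (⊕-identityʳ _))
    (run⇒quadrant ρ (ℤ.+≤+ z≤n , ℤ.+≤+ z≤n))

  quarter⇒run₀ : ∀ {q} → QuarterPlane vec q → ∃[ w ] Run₀ w q
  quarter⇒run₀ {q} ps with l , w , ρ ← backward-run (0 , 0) q
    -- The walk starts at the origin, and the only counter below the origin is `(0 , 0)`.
    with refl ← ⊑0⇒≡0 {l} (quadrant⇒⊑ ρ (All.map (subst InQuadrant (sym (⊕-identityʳ _))) ps))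
    = w , ρ

  words↔ : Σ[ φ ∈ (Words MotzkinInput ↔ Words (QuarterPlane vec)) ]
      (∀ w → Run₀ (value w) (value (Inverse.to φ w)))
    × (∀ q → Run₀ (value (Inverse.from φ q)) (value q))
  words↔ = relation⇒↔ Run₀ (Motzkin? ∘ List.map step) (QuarterPlane? vec)
    (λ m → let q , ρ = Motzkin⇒run₀ m in q , ρ , run₀⇒quarter ρ)
    (λ m → let w , ρ = quarter⇒run₀ m in w , ρ , run₀⇒Motzkin ρ)
    run-functional
    (λ ρ ρ′ → cong proj₁ (run-injective ρ ρ′))

  wordsOfLength↔ : ∀ n →
    Σ[ φ ∈ (WordsOfLength MotzkinInput n ↔ WordsOfLength (QuarterPlane vec) n) ]
      (∀ w → Run₀ (value w) (value (Inverse.to φ w)))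
    × (∀ q → Run₀ (value (Inverse.from φ q)) (value q))
  wordsOfLength↔ n =
    relation⇒↔ Run₀ (ofLength? (Motzkin? ∘ List.map step) n) (ofLength? (QuarterPlane? vec) n)
    (λ (m , eq) → let q , ρ = Motzkin⇒run₀ m in q , ρ , run₀⇒quarter ρ , trans (run-length ρ) eq)
    (λ (m , eq) → let w , ρ = quarter⇒run₀ m in
      w , ρ , run₀⇒Motzkin ρ , trans (sym (run-length ρ)) eq)
    run-functional
    (λ ρ ρ′ → cong proj₁ (run-injective ρ ρ′))

-- The two systems

size-step₁ : ∀ {a l r s} → Transition₁ a l (just (r , s)) → size r ≡ height a ℤ.+ size l
size-step₁ (U1 {α} {β}) = cong +_ (ℕ.+-suc α β)
size-step₁ (L2 {α} {β}) = cong +_ (sym (ℕ.+-suc α β))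
size-step₁ L1 = refl
size-step₁ D3 = refl
size-step₁ D2 = refl

error-negative₁ : ∀ {a l} → Transition₁ a l nothing → ¬ (0ℤ ℤ.≤ height a ℤ.+ size l)
error-negative₁ DE ()

-- Only in `D2` does the horizontal counter stay at 0 although the output moves right; `L1` plays
-- the same part vertically.
horizontal₁ : ∀ {a l r s} → Transition₁ a l (just (r , s)) →
              proj₁ l ⟶[ proj₁ (vec₁ s) ] proj₁ r
horizontal₁ U1 = follows refl
horizontal₁ L2 = follows refl
horizontal₁ L1 = follows refl
horizontal₁ D3 = follows refl
horizontal₁ D2 = ignores

vertical₁ : ∀ {a l r s} → Transition₁ a l (just (r , s)) →
            proj₂ l ⟶[ proj₂ (vec₁ s) ] proj₂ r
vertical₁ U1 = follows refl
vertical₁ L2 = follows refl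
vertical₁ L1 = ignores
vertical₁ D3 = follows refl
vertical₁ D2 = follows refl

-- A six-step transition whose output is a `base` letter can only be `unprimed`, so backward steps
-- of the three-step model are inherited.
backward₁ : ∀ r s → ∃[ al ] Transition₁ (proj₁ al) (proj₂ al) (just (r , s))
backward₁ r s with backward₁Sym r (base s)
... | _ , unprimed t = _ , t

system₁ : TransitionSystem Step S₁
system₁ = record
  { Transition = Transition₁ ; step = id ; vec = vec₁
  ; forward = forward₁ ; forward-unique = forward₁-unique
  ; backward = backward₁
  ; backward-unique = λ t t′ →
      cong (map proj₁ id) (backward₁Sym-unique (unprimed t) (unprimed t′))
  ; size-step = size-step₁ ; error-negative = error-negative₁
  ; horizontal = horizontal₁ ; vertical = vertical₁
  }

system₁Sym : TransitionSystem BicolStep S₁Sym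
system₁Sym = record
  { Transition = Transition₁Sym ; step = proj₁ ; vec = vec₁Sym
  ; forward = forward₁Sym ; forward-unique = forward₁Sym-unique
  ; backward = backward₁Sym ; backward-unique = backward₁Sym-unique
  ; size-step = size-step ; error-negative = error-negative
  ; horizontal = horizontal ; vertical = vertical
  }
  where
  size-step : ∀ {a l r s} → Transition₁Sym a l (just (r , s)) →
              size r ≡ height (proj₁ a) ℤ.+ size l
  size-step (unprimed t)  = size-step₁ t
  size-step U1′           = refl
  size-step (L2′ {α} {β}) = cong +_ (ℕ.+-suc α β)
  size-step L1′           = refl
  size-step (D3′ {α} {β}) rewrite ℕ.+-suc α β = refl
  size-step D2′           = refl

  error-negative : ∀ {a l} → Transition₁Sym a l nothing →
                   ¬ (0ℤ ℤ.≤ height (proj₁ a) ℤ.+ size l)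
  error-negative (unprimedError t) = error-negative₁ t
  error-negative DE′ ()

  horizontal : ∀ {a l r s} → Transition₁Sym a l (just (r , s)) →
               proj₁ l ⟶[ proj₁ (vec₁Sym s) ] proj₁ r
  horizontal (unprimed t) = horizontal₁ t
  horizontal U1′ = follows refl
  horizontal L2′ = follows refl
  horizontal L1′ = ignores
  horizontal D3′ = follows refl
  horizontal D2′ = follows refl

  vertical : ∀ {a l r s} → Transition₁Sym a l (just (r , s)) →
             proj₂ l ⟶[ proj₂ (vec₁Sym s) ] proj₂ r
  vertical (unprimed t) = vertical₁ t
  vertical U1′ = follows refl
  vertical L2′ = follows refl
  vertical L1′ = follows refl
  vertical D3′ = follows refl
  vertical D2′ = ignores

module T₁    = TransitionSystem system₁
module T₁Sym = TransitionSystem system₁Sym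

-- Identification with the computed maps

rightToLeft-run : ∀ q → T₁Sym.Run (proj₂ (rightToLeft q)) (proj₁ (rightToLeft q)) (0 , 0) q
rightToLeft-run []      = T₁Sym.[]
rightToLeft-run (s ∷ q) with rightToLeft q | rightToLeft-run q
... | w , r | ρ with backward₁Sym r s
... | (a , l) , t = t T₁Sym.∷ ρ

-- Both runs end at `(0 , 0)` with output `q`, so `run-injective` identifies them without prior
-- knowledge of the left counter that `rightToLeft` reaches.
run₀⇒Ψ₁Sym : ∀ {w q} → T₁Sym.Run₀ w q → w ≡ Ψ₁Sym q
run₀⇒Ψ₁Sym ρ = cong proj₁ (T₁Sym.run-injective ρ (rightToLeft-run _))

-- Bridges `Motzkin w` and `Motzkin (List.map id w)`, the form that `system₁` produces. Underlying
-- words are left unchanged, so nothing is lost in the comparison with `Φ₁`.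
WordsOfLength-cong : {P Q : List A → Set} → (∀ w → P w ≡ Q w) → ∀ n →
                     WordsOfLength P n ↔ WordsOfLength Q n
WordsOfLength-cong eq n = mk↔ₛ′
  (λ { (w , [ p ]) → w , [ map (subst id (eq w)) id p ] })
  (λ { (w , [ p ]) → w , [ map (subst id (sym (eq w))) id p ] })
  (λ _ → refl) (λ _ → refl)

motzkin↔quarter : ∀ n → WordsOfLength Motzkin n ↔ WordsOfLength Quarter n
motzkin↔quarter n =
  ↔-trans (WordsOfLength-cong (λ w → cong Motzkin (sym (map-id w))) n)
          (proj₁ (T₁.wordsOfLength↔ n))

motzkin↔quarter-Φ₁ : ∀ n w → Φ₁ (value w) ≡ just (value (Inverse.to (motzkin↔quarter n) w))
motzkin↔quarter-Φ₁ n (w , [ p ]) =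
  T₁.run-leftToRight (proj₁ (proj₂ (T₁.wordsOfLength↔ n))
    (Inverse.to (WordsOfLength-cong (λ w → cong Motzkin (sym (map-id w))) n) (w , [ p ])))

-- Colours

sides : List BicolStep → List Side
sides = List.map (stripedSide ∘ proj₂)

stripedSide-injective : Injective _≡_ _≡_ stripedSide
stripedSide-injective {solid}   {solid}   _ = refl
stripedSide-injective {striped} {striped} _ = refl

uncolour-sides-injective : ∀ w w′ → uncolour w ≡ uncolour w′ → sides w ≡ sides w′ → w ≡ w′
uncolour-sides-injective []      []        _  _  = refl
uncolour-sides-injective (_ ∷ w) (_ ∷ w′) eq eq′ =
  cong₂ _∷_
    (cong₂ _,_ (∷-injectiveˡ eq) (stripedSide-injective (∷-injectiveˡ eq′)))
    (uncolour-sides-injective w w′ (∷-injectiveʳ eq) (∷-injectiveʳ eq′))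

colour : Side → Colour
colour inside  = striped
colour outside = solid

-- The inverse of splitting off the colours. Since `zipWith` truncates to the shorter list, the
-- lemmas about it assume equal lengths.
recolour : List Step → List Side → List BicolStep
recolour = zipWith (λ a c → a , colour c)

uncolour-recolour : ∀ w cs → length w ≡ length cs → uncolour (recolour w cs) ≡ w
uncolour-recolour []      []       _  = refl
uncolour-recolour (a ∷ w) (c ∷ cs) eq = cong (a ∷_) (uncolour-recolour w cs (ℕ.suc-injective eq))

sides-recolour : ∀ w cs → length w ≡ length cs → sides (recolour w cs) ≡ cs
sides-recolour []      []             _  = refl
sides-recolour (a ∷ w) (inside ∷ cs)  eq =
  cong (inside ∷_) (sides-recolour w cs (ℕ.suc-injective eq))
sides-recolour (a ∷ w) (outside ∷ cs) eq =
  cong (outside ∷_) (sides-recolour w cs (ℕ.suc-injective eq))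

toList-cast : ∀ {m n} .(eq : m ≡ n) (xs : Vec A m) → toList (cast eq xs) ≡ toList xs
toList-cast {n = zero}  eq []       = refl
toList-cast {n = suc _} eq (x ∷ xs) = cong (x ∷_) (toList-cast (ℕ.suc-injective eq) xs)

-- Passing to lists removes the `cast`, so that bijectivity can be argued on lists.
toList-splitColours : ∀ n w → toList (proj₂ (splitColours n w)) ≡ sides (value w)
toList-splitColours n (w , [ _ ]) = trans (toList-cast _ _) (toList∘fromList (sides w))

splitColours-injective : ∀ n → Injective _≡_ _≡_ (splitColours n)
splitColours-injective n {x} {y} eq = value-injective
  (uncolour-sides-injective (value x) (value y) (cong (value ∘ proj₁) eq)
    (trans (sym (toList-splitColours n x))
      (trans (cong (toList ∘ proj₂) eq) (toList-splitColours n y))))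

splitColours-surjective : ∀ n → StrictlySurjective _≡_ (splitColours n)
splitColours-surjective n ((w , [ m ]) , s) = x ,
  cong₂ _,_ (value-injective w≡)
    (toList-injective-≡ _ s
      (trans (toList-splitColours n x) (sides-recolour w (toList s) equal-lengths)))
  where
  |w|≡n : length w ≡ n
  -- The equality is needed outside irrelevant positions, so it is recovered from decidability of
  -- equality on `ℕ`.
  |w|≡n = recompute (length w ℕ.≟ n) (proj₂ m)

  equal-lengths : length w ≡ length (toList s)
  equal-lengths = trans |w|≡n (sym (length-toList s))

  w≡ : uncolour (recolour w (toList s)) ≡ w
  w≡ = uncolour-recolour w (toList s) equal-lengths

  x : WordsOfLength BicolMotzkin n
  x = recolour w (toList s) ,
    [ ( subst Motzkin (sym w≡) (proj₁ m)
      , trans (sym (length-map proj₁ (recolour w (toList s)))) (trans (cong length w≡) |w|≡n)) ]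

splitColours-bijective : ∀ n → Bijective _≡_ _≡_ (splitColours n)
splitColours-bijective n =
  splitColours-injective n , strictlySurjective⇒surjective (splitColours-surjective n)

-- Counting

S₁-cardinality : HasCardinality S₁ 3
S₁-cardinality = mk↔ₛ′
  (λ { N → zero ; W → suc zero ; SE → suc (suc zero) })
  (λ { zero → N ; (suc zero) → W ; (suc (suc zero)) → SE })
  (λ { zero → refl ; (suc zero) → refl ; (suc (suc zero)) → refl })
  (λ { N → refl ; W → refl ; SE → refl })

Subset-cardinality : ∀ n → HasCardinality (Subset n) (2 ^ n)
Subset-cardinality n = Vec-cardinality n (↔-sym 2↔Bool)

-- Only the walks on `S₁` are counted by finiteness. The cardinality for `S₁Sym` is carried along
-- the chain of bijections, with the factors swapped so that it is literally `2 ^ n * b`.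
cardinalities : ∀ n → ∃[ a ] ∃[ b ] HasCardinality (WordsOfLength QuarterSym n) a
                                   × HasCardinality (WordsOfLength Quarter n) b
                                   × a ≡ 2 ^ n * b
cardinalities n with b , χ ← finite-WordsOfLength S₁-cardinality (QuarterPlane? vec₁) n =
  2 ^ n * b , b ,
  ↔-trans (↔-sym (proj₁ (T₁Sym.wordsOfLength↔ n)))
  (↔-trans (⤖⇒↔ (mk⤖ (splitColours-bijective n)))
  (↔-trans (×-comm _ _)
  (↔-trans (Subset-cardinality n ×-↔ ↔-trans (motzkin↔quarter n) χ)
           (↔-sym *↔×)))) ,
  χ , refl

theorem8 :
    (Σ[ φ ∈ (Words BicolMotzkin ↔ Words QuarterSym) ]
        (∀ w → Φ₁Sym (value w) ≡ just (value (Inverse.to φ w)))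
      × (∀ w → length (value (Inverse.to φ w)) ≡ length (value w))
      × (∀ q → value (Inverse.from φ q) ≡ Ψ₁Sym (value q)))
  × ((n : ℕ) →
        (Σ[ ψ ∈ (WordsOfLength QuarterSym n → WordsOfLength BicolMotzkin n) ]
            (∀ q → value (ψ q) ≡ Ψ₁Sym (value q))
          × Bijective _≡_ _≡_ ψ)
      × Bijective _≡_ _≡_ (splitColours n)
      × (Σ[ φ₁ ∈ (WordsOfLength Motzkin n → WordsOfLength Quarter n) ]
            (∀ w → Φ₁ (value w) ≡ just (value (φ₁ w)))
          × Bijective _≡_ _≡_ (map {Q = λ _ → Subset n} φ₁ id))
      × (∃[ a ] ∃[ b ]
            HasCardinality (WordsOfLength QuarterSym n) a
          × HasCardinality (WordsOfLength Quarter n) b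
          × a ≡ 2 ^ n * b))
theorem8 =
  ( proj₁ T₁Sym.words↔
  , (λ w → T₁Sym.run-leftToRight (proj₁ (proj₂ T₁Sym.words↔) w))
  , (λ w → T₁Sym.run-length (proj₁ (proj₂ T₁Sym.words↔) w))
  , (λ q → run₀⇒Ψ₁Sym (proj₂ (proj₂ T₁Sym.words↔) q)) ) ,
  λ n →
    ( Inverse.from (proj₁ (T₁Sym.wordsOfLength↔ n))
    , (λ q → run₀⇒Ψ₁Sym (proj₂ (proj₂ (T₁Sym.wordsOfLength↔ n)) q))
    , Bijection.bijective (↔⇒⤖ (↔-sym (proj₁ (T₁Sym.wordsOfLength↔ n)))) ) ,
    splitColours-bijective n ,
    ( Inverse.to (motzkin↔quarter n)
    , motzkin↔quarter-Φ₁ n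
    , Bijection.bijective (↔⇒⤖ (motzkin↔quarter n ×-↔ ↔-refl)) ) ,
    cardinalities n
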